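{- $gr^3_2(B_7)=12$.
   Context: $K_n$ is the complete graph of order $n$. The book $B_n:=K_2+nK_1$ (graph join) is the graph on $n+2$ vertices consisting of an edge $xy$ (the spine) together with $n$ further, pairwise non-adjacent vertices (the pages), each adjacent to both $x$ and $y$. A $t$-coloring of $K_p$ is a map $f:E(K_p)\to\{1,\dots,t\}$, not assumed surjective. A Gallai $t$-coloring is a $t$-coloring with no rainbow triangle, i.e. there are no three vertices $x,y,z$ such that $f(xy),f(xz),f(yz)$ are pairwise distinct. For $1\le s<t$ and a graph $G$, the weakened Gallai-Ramsey number $gr^t_s(G)$ is the least $p\in\mathbb{N}$ such that every Gallai $t$-coloring of $K_p$ contains a (not necessarily induced) subgraph isomorphic to $G$ whose edges use at most $s$ colors. -}

module Defs where

open import Data.Nat.Base using (ℕ; _≤_; _<_)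
open import Data.Fin.Base using (Fin)
open import Data.Fin.Subset using (_∈_; ∣_∣)
open import Data.Product.Base using (_×_; ∃-syntax)
open import Data.Sum.Base using (_⊎_; inj₁; inj₂)
open import Data.Empty using (⊥)
open import Data.Unit.Base using (⊤; tt)
open import Function.Definitions using (Injective)
open import Relation.Binary.PropositionalEquality.Core using (_≡_; _≢_; refl; ≢-sym)
open import Relation.Nullary.Negation.Core using (¬_)

record Graph : Set₁ where
  field
    Vertex : Set
    Adj    : Vertex → Vertex → Set
    sym    : ∀ {u v} → Adj u v → Adj v u
    irrefl : ∀ {v} → ¬ Adj v v

open Graph public using (Vertex; Adj)

K : ℕ → Graph
K n = record
  { Vertex = Fin n
  ; Adj    = _≢_
  ; sym    = ≢-sym
  ; irrefl = λ v≢v → v≢v refl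
  }

-- n K₁, the graph consisting of n isolated vertices.
isolated : ℕ → Graph
isolated n = record
  { Vertex = Fin n
  ; Adj    = λ _ _ → ⊥
  ; sym    = λ ()
  ; irrefl = λ ()
  }

module _ (G H : Graph) where

  JoinAdj : Vertex G ⊎ Vertex H → Vertex G ⊎ Vertex H → Set
  JoinAdj (inj₁ u) (inj₁ v) = Adj G u v
  JoinAdj (inj₁ _) (inj₂ _) = ⊤
  JoinAdj (inj₂ _) (inj₁ _) = ⊤
  JoinAdj (inj₂ u) (inj₂ v) = Adj H u v

  joinSym : ∀ u v → JoinAdj u v → JoinAdj v u
  joinSym (inj₁ _) (inj₁ _) e = Graph.sym G e
  joinSym (inj₁ _) (inj₂ _) _ = tt
  joinSym (inj₂ _) (inj₁ _) _ = tt
  joinSym (inj₂ _) (inj₂ _) e = Graph.sym H e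

  joinIrrefl : ∀ v → ¬ JoinAdj v v
  joinIrrefl (inj₁ _) = Graph.irrefl G
  joinIrrefl (inj₂ _) = Graph.irrefl H

  join : Graph
  join = record
    { Vertex = Vertex G ⊎ Vertex H
    ; Adj    = JoinAdj
    ; sym    = λ {u} {v} → joinSym u v
    ; irrefl = λ {v} → joinIrrefl v
    }

Book : ℕ → Graph
Book n = join (K 2) (isolated n)

-- A map from the edge set of G to t colours. An edge is an unordered adjacent
-- pair: the colour is the same for both orders of the endpoints, and it does
-- not depend on the proof of adjacency, which is irrelevant.
record Colouring (t : ℕ) (G : Graph) : Set where
  field
    colour    : ∀ u v → .(Adj G u v) → Fin t
    symmetric : ∀ u v .(e : Adj G u v) → colour u v e ≡ colour v u (Graph.sym G e)

open Colouring public using (colour)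

IsGallai : ∀ {t p} → Colouring t (K p) → Set
IsGallai {p = p} f =
  ∀ (x y z : Fin p) (xy : x ≢ y) (xz : x ≢ z) (yz : y ≢ z) →
  ¬ ( colour f x y xy ≢ colour f x z xz
    × colour f x y xy ≢ colour f y z yz
    × colour f x z xz ≢ colour f y z yz )

-- A not necessarily induced subgraph of H isomorphic to G.
record Copy (G H : Graph) : Set where
  field
    embed     : Vertex G → Vertex H
    injective : Injective _≡_ _≡_ embed
    preserves : ∀ {u v} → Adj G u v → Adj H (embed u) (embed v)

UsesAtMost : ∀ {t G H} → ℕ → Colouring t H → Copy G H → Set
UsesAtMost {t} {G} s f c =
  ∃[ S ] ∣ S ∣ ≤ s ×
    (∀ u v (e : Adj G u v) → colour f (embed u) (embed v) (preserves e) ∈ S)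
  where open Copy c

GallaiRamseyProperty : (t s : ℕ) → Graph → ℕ → Set
GallaiRamseyProperty t s G p =
  ∀ (f : Colouring t (K p)) → IsGallai f →
  ∃[ c ] UsesAtMost {G = G} s f c

IsLeast : (ℕ → Set) → ℕ → Set
IsLeast P p = P p × (∀ q → P q → p ≤ q)

-- gr^t_s(G) = p, as a relation because the existence of gr^t_s(G) is part of
-- the claim. The index ranges over 1 ≤ s < t.
IsWeakenedGallaiRamseyNumber :
  (t s : ℕ) → 1 ≤ s → s < t → Graph → ℕ → Set
IsWeakenedGallaiRamseyNumber t s _ _ G = IsLeast (GallaiRamseyProperty t s G)

{-# OPTIONS --safe #-}
module Submission where

-- K₁₂ has a 2-coloured B₇ avoiding colour c with spine xy, where xy is not coloured c, unless c joins
-- at least 4 vertices to x or y; suppose it always does. In a Gallai 3-colouring some colour a is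
-- disconnected, and the edges between two of its components have a single colour, so either a has four
-- components or the vertices split into two sides with all edges between them of one colour d.
--
-- Four components: the closed a-neighbourhoods of one vertex from each fill K₁₂, so the components are
-- a-cliques. A vertex w sees two other components in the same colour, so that colour takes too much of
-- the degree of w.
--
-- Two sides: take one with at most 6 vertices. If a vertex in it has all its edges coloured d, the
-- other 11 vertices satisfy degree conditions that the same dichotomy refutes. Otherwise the side has 6
-- vertices, no edge coloured d, and no monochromatic triangle, against R(3,3) ≤ 6.

open import Defs
open import Data.Bool.Base using (true; false; if_then_else_)
open import Data.Empty using (⊥; ⊥-elim)
open import Data.Fin.Base using (Fin; zero; suc; inject≤; punchIn)
open import Data.Fin.Patterns using (0F; 1F; 2F)
open import Data.Fin.Properties using (_≟_; all?; any?; ¬∀⟶∃¬; suc-injective; punchIn-injective; punchInᵢ≢i; inject≤-injective)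
open import Data.Fin.Subset using (Subset; _∈_; _∉_; ∣_∣; ∁; ⁅_⁆)
open import Data.Fin.Subset.Properties using (_∈?_; anySubset?; x∉p⇒x∈∁p; x∈⁅y⁆⇒x≡y)
open import Data.Maybe.Base using (Maybe; just; nothing)
open import Data.Maybe.Properties using (just-injective; ≡-dec)
open import Data.Nat.Base using (ℕ; zero; suc; _+_; _≤_; _<_; z≤n; s≤s; s≤s⁻¹)
open import Data.Nat.Properties using (≤-refl; ≤-reflexive; ≤-trans; m≤n⇒m≤1+n; n≤1+n; m≤m+n; ≰⇒>; ≮⇒≥; +-mono-≤; +-monoˡ-≤; +-monoʳ-≤; +-cancelˡ-≤; +-cancelʳ-≤; +-suc; _≤?_; module ≤-Reasoning)
open import Data.Nat.Tactic.RingSolver using (solve-∀)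
open import Data.Product.Base using (_×_; _,_; proj₁; proj₂; ∃-syntax)
open import Data.Sum.Base using (_⊎_; inj₁; inj₂; [_,_]′)
open import Data.Sum.Properties using (inj₂-injective)
open import Data.Unit.Base using (tt)
open import Data.Vec.Base using (Vec; []; _∷_; there; tabulate; lookup)
open import Data.Vec.Properties using (lookup∘tabulate; []=⇒lookup; lookup⇒[]=)
open import Function.Base using (_∘_; id)
open import Function.Definitions using (Injective)
open import Level using (0ℓ)
open import Relation.Binary.PropositionalEquality using (_≡_; _≢_; refl; sym; ≢-sym; trans; cong; subst)
open import Relation.Nullary using (¬_; Dec; yes; no; does; contradiction)
open import Relation.Nullary.Decidable using (_×-dec_; _→-dec_; _⊎-dec_; ¬?; toWitness; toWitnessFalse; decidable-stable; dec-true)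
open import Relation.Unary using (Pred; Decidable; _∪_; _∩_)
open import Relation.Unary.Properties using (_∪?_; _∩?_)

private
  variable
    m n : ℕ

-- Counting

count : {P : Pred (Fin n) 0ℓ} → Decidable P → ℕ
count {zero}  P? = 0
count {suc n} P? = if does (P? zero) then suc (count (P? ∘ suc)) else count (P? ∘ suc)

count≤n : {P : Pred (Fin n) 0ℓ} (P? : Decidable P) → count P? ≤ n
count≤n {zero}  P? = z≤n
count≤n {suc n} P? with does (P? zero)
... | true  = s≤s (count≤n (P? ∘ suc))
... | false = m≤n⇒m≤1+n (count≤n (P? ∘ suc))

count-cover : {P Q R : Pred (Fin n) 0ℓ} (P? : Decidable P) (Q? : Decidable Q) (R? : Decidable R) →
              (∀ i → P i → Q i ⊎ R i) → count P? ≤ count Q? + count R?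
count-cover {zero}  P? Q? R? P⊆Q∪R = z≤n
count-cover {suc n} P? Q? R? P⊆Q∪R
  with P? zero | Q? zero | R? zero | count-cover (P? ∘ suc) (Q? ∘ suc) (R? ∘ suc) (P⊆Q∪R ∘ suc)
... | no  _ | yes _ | yes _ | ih = m≤n⇒m≤1+n (≤-trans ih (+-mono-≤ ≤-refl (m≤n⇒m≤1+n ≤-refl)))
... | no  _ | yes _ | no  _ | ih = m≤n⇒m≤1+n ih
... | no  _ | no  _ | yes _ | ih = ≤-trans ih (+-mono-≤ ≤-refl (m≤n⇒m≤1+n ≤-refl))
... | no  _ | no  _ | no  _ | ih = ih
... | yes _ | yes _ | yes _ | ih = s≤s (≤-trans ih (+-mono-≤ ≤-refl (m≤n⇒m≤1+n ≤-refl)))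
... | yes _ | yes _ | no  _ | ih = s≤s ih
... | yes _ | no  _ | yes _ | ih = ≤-trans (s≤s ih) (≤-reflexive (sym (+-suc _ _)))
... | yes p | no ¬q | no ¬r | ih = ⊥-elim ([ ¬q , ¬r ]′ (P⊆Q∪R zero p))

count-mono : {P Q : Pred (Fin n) 0ℓ} (P? : Decidable P) (Q? : Decidable Q) →
             (∀ i → P i → Q i) → count P? ≤ count Q?
count-mono {zero}  P? Q? P⊆Q = z≤n
count-mono {suc n} P? Q? P⊆Q with P? zero | Q? zero | count-mono (P? ∘ suc) (Q? ∘ suc) (P⊆Q ∘ suc)
... | yes _ | yes _ | ih = s≤s ih
... | yes p | no ¬q | ih = contradiction (P⊆Q zero p) ¬q
... | no  _ | yes _ | ih = m≤n⇒m≤1+n ih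
... | no  _ | no  _ | ih = ih

count-disjoint : {P Q : Pred (Fin n) 0ℓ} (P? : Decidable P) (Q? : Decidable Q) →
                 (∀ i → P i → ¬ Q i) → count P? + count Q? ≤ count (P? ∪? Q?)
count-disjoint {zero}  P? Q? P∩Q=∅ = z≤n
count-disjoint {suc n} P? Q? P∩Q=∅
  with P? zero | Q? zero | count-disjoint (P? ∘ suc) (Q? ∘ suc) (P∩Q=∅ ∘ suc)
... | yes p | yes q | ih = contradiction q (P∩Q=∅ zero p)
... | yes _ | no  _ | ih = s≤s ih
... | no  _ | yes _ | ih = ≤-trans (≤-reflexive (+-suc _ _)) (s≤s ih)
... | no  _ | no  _ | ih = ih

count-singleton : (x : Fin n) → 1 ≤ count (_≟ x)
count-singleton zero    = s≤s z≤n
count-singleton (suc x) = ≤-trans (count-singleton x) (count-mono (_≟ x) (λ i → suc i ≟ suc x) (λ _ → cong suc))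

count-empty : {P : Pred (Fin n) 0ℓ} (P? : Decidable P) → (∀ i → ¬ P i) → count P? ≤ 0
count-empty {zero}  P? ¬p = z≤n
count-empty {suc n} P? ¬p with P? zero
... | yes p = contradiction p (¬p zero)
... | no  _ = count-empty (P? ∘ suc) (¬p ∘ suc)

count-singleton≤1 : (x : Fin n) → count (_≟ x) ≤ 1
count-singleton≤1 {suc n} zero = s≤s (count-empty {P = λ (i : Fin n) → suc i ≡ zero} (λ i → suc i ≟ zero) (λ _ ()))
count-singleton≤1 (suc x) = ≤-trans (count-mono (λ i → suc i ≟ suc x) (_≟ x) (λ _ → suc-injective)) (count-singleton≤1 x)

count-punchIn : {P : Pred (Fin (suc n)) 0ℓ} (P? : Decidable P) (v : Fin (suc n)) →
                count P? ≤ suc (count (P? ∘ punchIn v))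
count-punchIn P? zero with does (P? zero)
... | true  = ≤-refl
... | false = m≤n⇒m≤1+n ≤-refl
count-punchIn {suc n} P? (suc v) with does (P? zero)
... | true  = s≤s (count-punchIn (P? ∘ suc) v)
... | false = count-punchIn (P? ∘ suc) v

count-punchIn-∉ : {P : Pred (Fin (suc n)) 0ℓ} (P? : Decidable P) (v : Fin (suc n)) → ¬ P v →
                  count P? ≤ count (P? ∘ punchIn v)
count-punchIn-∉ P? zero ¬p with P? zero
... | yes p = contradiction p ¬p
... | no  _ = ≤-refl
count-punchIn-∉ {suc n} P? (suc v) ¬p with does (P? zero)
... | true  = s≤s (count-punchIn-∉ (P? ∘ suc) v ¬p)
... | false = count-punchIn-∉ (P? ∘ suc) v ¬p

-- Turns a bound on a count into distinct vertices, such as the three neighbours in the triangle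
-- argument or the seven pages of a book.
choose : {P : Pred (Fin n) 0ℓ} (P? : Decidable P) → m ≤ count P? →
         ∃[ g ] Injective _≡_ _≡_ g × (∀ (i : Fin m) → P (g i))
choose {m = zero} P? m≤ = (λ ()) , (λ { {()} }) , λ ()
choose {zero} {suc m} P? ()
choose {suc n} {suc m} P? m≤ with P? zero
choose {suc n} {suc m} {P} P? (s≤s m≤) | yes p with choose (P? ∘ suc) m≤
... | g , g-inj , Pg = h , h-inj , Ph
  where
  h : Fin (suc m) → Fin (suc n)
  h zero    = zero
  h (suc i) = suc (g i)
  h-inj : Injective _≡_ _≡_ h
  h-inj {zero}  {zero}  _  = refl
  h-inj {suc i} {suc j} eq = cong suc (g-inj (suc-injective eq))
  Ph : ∀ i → P (h i)
  Ph zero    = p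
  Ph (suc i) = Pg i
choose {suc n} {suc m} P? m≤ | no _ with choose (P? ∘ suc) m≤
... | g , g-inj , Pg = suc ∘ g , g-inj ∘ suc-injective , Pg

-- By induction on `m`: the rest of the injection lands in `P` with `g zero` removed.
injective⇒≤count : {P : Pred (Fin n) 0ℓ} (P? : Decidable P) (g : Fin m → Fin n) →
                   Injective _≡_ _≡_ g → (∀ i → P (g i)) → m ≤ count P?
injective⇒≤count {m = zero}  P? g g-inj Pg = z≤n
injective⇒≤count {m = suc m} {P} P? g g-inj Pg = begin
  suc m                                  ≤⟨ +-mono-≤ (count-singleton (g zero))
                                                     (injective⇒≤count rest? (g ∘ suc) (suc-injective ∘ g-inj)
                                                       (λ i → Pg (suc i) , λ eq → case-0≡suc (g-inj eq))) ⟩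
  count (_≟ g zero) + count rest?        ≤⟨ count-disjoint (_≟ g zero) rest? (λ _ eq → λ (_ , neq) → neq eq) ⟩
  count ((_≟ g zero) ∪? rest?)           ≤⟨ count-mono ((_≟ g zero) ∪? rest?) P?
                                              (λ { _ (inj₁ refl) → Pg zero ; _ (inj₂ (p , _)) → p }) ⟩
  count P?                               ∎
  where
  open ≤-Reasoning
  rest? : Decidable (P ∩ (_≢ g zero))
  rest? = P? ∩? (λ i → ¬? (i ≟ g zero))
  case-0≡suc : ∀ {i : Fin m} → ¬ suc i ≡ zero
  case-0≡suc ()

-- Gallai colourings and their components

Colour : Set
Colour = Fin 3

third-colour : (a b : Colour) → ∃[ c ] c ≢ a × c ≢ b
third-colour = toWitness {a? = all? λ a → all? λ b → any? λ c → ¬? (c ≟ a) ×-dec ¬? (c ≟ b)} tt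

-- Pigeonhole: only two colours differ from a.
two-equal : (a b c d : Colour) → b ≢ a → c ≢ a → d ≢ a → b ≡ c ⊎ b ≡ d ⊎ c ≡ d
two-equal = toWitness {a? = all? λ a → all? λ b → all? λ c → all? λ d →
  ¬? (b ≟ a) →-dec ¬? (c ≟ a) →-dec ¬? (d ≟ a) →-dec (b ≟ c ⊎-dec b ≟ d ⊎-dec c ≟ d)} tt

third-unique : {a b c d : Colour} → b ≢ a → c ≢ a → d ≢ a → c ≢ b → d ≢ b → c ≡ d
third-unique {a} {b} {c} {d} b≢a c≢a d≢a c≢b d≢b with two-equal a b c d b≢a c≢a d≢a
... | inj₁ b≡c        = contradiction (sym b≡c) c≢b
... | inj₂ (inj₁ b≡d) = contradiction (sym b≡d) d≢b
... | inj₂ (inj₂ c≡d) = c≡d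

-- A Gallai 3-colouring of Kₙ as a symmetric matrix; nothing marks the diagonal.
record Gallai (n : ℕ) : Set where
  field
    col        : Fin n → Fin n → Maybe Colour
    col-sym    : ∀ x y → col x y ≡ col y x
    col-diag   : ∀ x → col x x ≡ nothing
    col-off    : ∀ {x y} → x ≢ y → ∃[ c ] col x y ≡ just c
    no-rainbow : ∀ {x y z a b c} → col x y ≡ just a → col x z ≡ just b → col y z ≡ just c →
                 a ≡ b ⊎ a ≡ c ⊎ b ≡ c

open Gallai

restrict : (g : Fin m → Fin n) → Injective _≡_ _≡_ g → Gallai n → Gallai m
restrict g g-inj G = record
  { col        = λ x y → col G (g x) (g y)
  ; col-sym    = λ x y → col-sym G (g x) (g y)
  ; col-diag   = λ x → col-diag G (g x)
  ; col-off    = λ x≢y → col-off G (x≢y ∘ g-inj)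
  ; no-rainbow = no-rainbow G
  }

module _ (G : Gallai n) where

  Edge : Colour → Fin n → Fin n → Set
  Edge c x y = col G x y ≡ just c

  edge? : ∀ c x y → Dec (Edge c x y)
  edge? c x y = ≡-dec _≟_ (col G x y) (just c)

  edge-sym : ∀ {c x y} → Edge c x y → Edge c y x
  edge-sym {x = x} {y} e = trans (col-sym G y x) e

  edge-irrefl : ∀ {c x} → ¬ Edge c x x
  edge-irrefl {x = x} e with trans (sym e) (col-diag G x)
  ... | ()

  edge⇒≢ : ∀ {c x y} → Edge c x y → x ≢ y
  edge⇒≢ e refl = edge-irrefl e

  edge-functional : ∀ {c d x y} → Edge c x y → Edge d x y → c ≡ d
  edge-functional e e′ = just-injective (trans (sym e) e′)

  Closed : Colour → Subset n → Set
  Closed a S = ∀ u v → Edge a u v → u ∈ S → v ∈ S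

  -- Quantifying over closed sets instead of paths makes connectedness decidable by a search over subsets.
  Connected : Colour → Fin n → Fin n → Set
  Connected a x y = ∀ S → Closed a S → x ∈ S → y ∈ S

  abstract
    connected? : ∀ a x y → Dec (Connected a x y)
    connected? a x y with anySubset? (λ S →
      (all? λ u → all? λ v → edge? a u v →-dec u ∈? S →-dec v ∈? S) ×-dec x ∈? S ×-dec ¬? (y ∈? S))
    ... | yes (S , closed , x∈S , y∉S) = no λ conn → y∉S (conn S closed x∈S)
    ... | no ¬sep = yes λ S closed x∈S → decidable-stable (y ∈? S) λ y∉S → ¬sep (S , closed , x∈S , y∉S)

  -- Induction along a path: a decidable `P` preserved by edges of colour `a` cuts out a closed
  -- subset, to which `Connected` is applied.
  connected-ind : ∀ {a x y} {P : Pred (Fin n) 0ℓ} → Decidable P →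
                  (∀ {u v} → Edge a u v → P u → P v) → Connected a x y → P x → P y
  connected-ind {a} {x} {y} {P} P? step conn px = from (conn S (λ u v e → to ∘ step e ∘ from) (to px))
    where
    S : Subset n
    S = tabulate (does ∘ P?)
    to : ∀ {u} → P u → u ∈ S
    to {u} p = lookup⇒[]= u S (trans (lookup∘tabulate (does ∘ P?) u) (dec-true (P? u) p))
    from : ∀ {u} → u ∈ S → P u
    from {u} u∈S with P? u | trans (sym (lookup∘tabulate (does ∘ P?) u)) ([]=⇒lookup u∈S)
    ... | yes p | _ = p

  connected-refl : ∀ {a x} → Connected a x x
  connected-refl _ _ x∈S = x∈S

  edge⇒connected : ∀ {a x y} → Edge a x y → Connected a x y
  edge⇒connected e S closed = closed _ _ e

  connected-trans : ∀ {a x y z} → Connected a x y → Connected a y z → Connected a x z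
  connected-trans p q S closed = q S closed ∘ p S closed

  connected-sym : ∀ {a x y} → Connected a x y → Connected a y x
  connected-sym {a} {x} p =
    connected-ind (λ u → connected? a u x) (λ e → connected-trans (edge⇒connected (edge-sym e))) p connected-refl

  ¬connected-sym : ∀ {a x y} → ¬ Connected a x y → ¬ Connected a y x
  ¬connected-sym ¬p p = ¬p (connected-sym p)

  ¬connected⇒≢ : ∀ {a x y} → ¬ Connected a x y → x ≢ y
  ¬connected⇒≢ ¬p refl = ¬p connected-refl

  crossing : ∀ {a x y} → ¬ Connected a x y → ∃[ c ] c ≢ a × Edge c x y
  crossing ¬p with col-off G (¬connected⇒≢ ¬p)
  ... | c , e = c , (λ { refl → ¬p (edge⇒connected e) }) , e

  -- For an edge `uv` of colour `a` in the component of `x`, the edges `uy` and `vy` are not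
  -- coloured `a`, so they agree, as the triangle is not rainbow. Induction along the component
  -- carries the colour from `x` to `x′`.
  component-module : ∀ {a x x′ y} → Connected a x x′ → ¬ Connected a x y → col G x′ y ≡ col G x y
  component-module {a} {x} {x′} {y} p ¬q =
    proj₂ (connected-ind (λ z → connected? a x z ×-dec ≡-dec _≟_ (col G z y) (col G x y)) step p (connected-refl , refl))
    where
    step : ∀ {u v} → Edge a u v → Connected a x u × col G u y ≡ col G x y →
           Connected a x v × col G v y ≡ col G x y
    step {u} {v} e (xu , eq) = xv , trans same eq
      where
      xv : Connected a x v
      xv = connected-trans xu (edge⇒connected e)
      same : col G v y ≡ col G u y
      same with crossing (¬q ∘ connected-trans xu) | crossing (¬q ∘ connected-trans xv)
      ... | c , c≢a , uy | d , d≢a , vy with no-rainbow G e uy vy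
      ... | inj₁ a≡c         = contradiction (sym a≡c) c≢a
      ... | inj₂ (inj₁ a≡d)  = contradiction (sym a≡d) d≢a
      ... | inj₂ (inj₂ refl) = trans vy (sym uy)

  components-uniform : ∀ {a x x′ y y′} → Connected a x x′ → Connected a y y′ → ¬ Connected a x y →
                       col G x′ y′ ≡ col G x y
  components-uniform {x = x} {x′} {y} {y′} p q ¬r =
    trans (col-sym G x′ y′)
      (trans (component-module q (λ r → ¬r (connected-trans p (connected-sym r))))
        (trans (col-sym G y x′) (component-module p ¬r)))

-- Adding the vertex zero to a Gallai colouring whose colour a is disconnected.
module _ (G : Gallai (suc n)) (a : Colour) where

  private
    G′ : Gallai n
    G′ = restrict suc suc-injective G

    Component : Fin n → Pred (Fin (suc n)) 0ℓ
    Component z zero    = ⊥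
    Component z (suc u) = Connected G′ a z u

    component? : ∀ z → Decidable (Component z)
    component? z zero    = no id
    component? z (suc u) = connected? G′ a z u

    Meets : Fin n → Set
    Meets u = ∃[ w ] Connected G′ a u w × Edge G a zero (suc w)

    meets? : Decidable Meets
    meets? u = any? λ w → connected? G′ a u w ×-dec edge? G a zero (suc w)

  -- The component of `u` in `G′` stays closed in `G`, since no edge of colour `a` leads from it to
  -- the new vertex.
  ¬meets⇒¬connected : ∀ {u} → ¬ Meets u → ¬ Connected G a (suc u) zero
  ¬meets⇒¬connected {u} ¬meets p = connected-ind G (component? u) step p (connected-refl G′)
    where
    step : ∀ {v w} → Edge G a v w → Component u v → Component u w
    step {suc v} {zero}  e p = ¬meets (v , p , edge-sym G e)
    step {suc v} {suc w} e p = connected-trans G′ p (edge⇒connected G′ e)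

  module _ {z : Fin n} {b c : Colour} (b≢a : b ≢ a) (c≢a : c ≢ a) (c≢b : c ≢ b)
           (meets : ∀ u → Meets u) (0z : Edge G b zero (suc z)) where

    -- A neighbour w′ of 0 in the component of w forces the colour b of 0z on z w′.
    crossing-b : ∀ {u w} → Connected G′ a z u → ¬ Connected G′ a z w → Edge G b (suc u) (suc w)
    crossing-b {u} {w} zu ¬zw = from-meet (meets w)
      where
      from-meet : Meets w → Edge G b (suc u) (suc w)
      from-meet (w′ , ww′ , 0w′) = from-crossing (crossing G′ ¬zw′)
        where
        ¬zw′ : ¬ Connected G′ a z w′
        ¬zw′ zw′ = ¬zw (connected-trans G′ zw′ (connected-sym G′ ww′))
        from-crossing : ∃[ q ] q ≢ a × Edge G′ q z w′ → Edge G b (suc u) (suc w)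
        from-crossing (q , q≢a , zw′) with no-rainbow G 0z 0w′ zw′
        ... | inj₁ b≡a         = contradiction b≡a b≢a
        ... | inj₂ (inj₂ a≡q)  = contradiction (sym a≡q) q≢a
        ... | inj₂ (inj₁ refl) =
          trans (components-uniform G′ zu (connected-sym G′ ww′) ¬zw′) zw′

    -- The component of `z` is closed in colour `c`: its edges to other components have colour `b`,
    -- and an edge of colour `c` from it to `zero` would complete a rainbow triangle with an
    -- `a`-neighbour of `zero` in the component of `w`.
    third-colour-disconnected : ∀ {w} → ¬ Connected G′ a z w → ¬ Connected G c (suc z) (suc w)
    third-colour-disconnected {w} ¬zw p = ¬zw (connected-ind G (component? z) step p (connected-refl G′))
      where
      leave : ∀ {u} → Connected G′ a z u → Meets w → ¬ Edge G c zero (suc u)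
      leave zu (w′ , ww′ , 0w′) e
        with no-rainbow G e 0w′ (crossing-b zu (λ zw′ → ¬zw (connected-trans G′ zw′ (connected-sym G′ ww′))))
      ... | inj₁ c≡a        = c≢a c≡a
      ... | inj₂ (inj₁ c≡b) = c≢b c≡b
      ... | inj₂ (inj₂ a≡b) = b≢a (sym a≡b)
      step : ∀ {u v} → Edge G c u v → Component z u → Component z v
      step {suc u} {zero}  e zu = leave zu (meets w) (edge-sym G e)
      step {suc u} {suc v} e zu = decidable-stable (connected? G′ a z v)
        λ ¬zv → c≢b (edge-functional G e (crossing-b zu ¬zv))

  -- If some component of `a` has no edge of colour `a` to `zero`, then `a` stays disconnected. If
  -- all have one and some edge at `zero` has another colour `b`, the third colour is disconnected.
  -- If every edge at `zero` has colour `a`, any other colour isolates `zero`.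
  extend-disconnected : ∀ {x y} → ¬ Connected G′ a x y → ∃[ c ] ∃[ u ] ∃[ v ] ¬ Connected G c u v
  extend-disconnected {x} {y} ¬xy = by-meets (all? meets?)
    where
    outside : ∀ z → ∃[ w ] ¬ Connected G′ a z w
    outside z with connected? G′ a z x
    ... | no ¬zx = x , ¬zx
    ... | yes zx = y , λ zy → ¬xy (connected-trans G′ (connected-sym G′ zx) zy)
    by-neighbour : (∀ u → Meets u) → Dec (∃[ z ] ¬ Edge G a zero (suc z)) →
                   ∃[ c ] ∃[ u ] ∃[ v ] ¬ Connected G c u v
    by-neighbour meets (yes (z , ¬0z)) with col-off G {zero} {suc z} (λ ())
    ... | b , 0z with third-colour a b
    ... | c , c≢a , c≢b = c , suc z , suc (proj₁ (outside z)) ,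
      third-colour-disconnected (λ { refl → ¬0z 0z }) c≢a c≢b meets 0z (proj₂ (outside z))
    by-neighbour meets (no ¬other) with third-colour a a
    ... | b , b≢a , _ = b , zero , suc x , λ p → zero≢suc (connected-ind G (_≟ zero) step p refl)
      where
      zero≢suc : ¬ suc x ≡ zero
      zero≢suc ()
      step : ∀ {u v} → Edge G b u v → u ≡ zero → v ≡ zero
      step {v = zero}  e refl = refl
      step {v = suc v} e refl = contradiction
        (edge-functional G e (decidable-stable (edge? G a zero (suc v)) λ ¬e → ¬other (v , ¬e))) b≢a
    by-meets : Dec (∀ u → Meets u) → ∃[ c ] ∃[ u ] ∃[ v ] ¬ Connected G c u v
    by-meets (yes meets) = by-neighbour meets (any? λ z → ¬? (edge? G a zero (suc z)))
    by-meets (no ¬meets) with ¬∀⟶∃¬ _ _ meets? ¬meets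
    ... | u , ¬u = a , suc u , zero , ¬meets⇒¬connected ¬u

-- Induction on the order. On two vertices, any colour other than that of the single edge is
-- disconnected.
disconnected : ∀ n (G : Gallai (2 + n)) → ∃[ a ] ∃[ x ] ∃[ y ] ¬ Connected G a x y
disconnected zero G with col-off G {zero} {suc zero} (λ ())
... | c , e with third-colour c c
... | a , a≢c , _ = a , zero , suc zero , λ p → one≢zero (connected-ind G (_≟ zero) step p refl)
  where
  one≢zero : ¬ suc zero ≡ zero
  one≢zero ()
  step : ∀ {u v} → Edge G a u v → u ≡ zero → v ≡ zero
  step {v = zero}     e′ refl = refl
  step {v = suc zero} e′ refl = contradiction (edge-functional G e′ e) a≢c
disconnected (suc n) G with disconnected n (restrict suc suc-injective G)
... | a , _ , _ , ¬xy = extend-disconnected G a ¬xy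

-- Structure of Gallai colourings: four components or a homogeneous cut

record HomogeneousCut (G : Gallai n) : Set₁ where
  field
    Side       : Pred (Fin n) 0ℓ
    side?      : Decidable Side
    in-side    : ∃[ x ] Side x
    off-side   : ∃[ y ] ¬ Side y
    cut-colour : Colour
    cross      : ∀ {u v} → Side u → ¬ Side v → Edge G cut-colour u v

other-side : {G : Gallai n} → HomogeneousCut G → HomogeneousCut G
other-side {G = G} C = record
  { Side = λ u → ¬ Side u ; side? = λ u → ¬? (side? u) ; in-side = off-side
  ; off-side = proj₁ in-side , λ ¬s → ¬s (proj₂ in-side) ; cut-colour = cut-colour
  ; cross = λ {u} {v} ¬su ¬¬sv → edge-sym G (cross (decidable-stable (side? v) ¬¬sv) ¬su) }
  where open HomogeneousCut C

record Separated (G : Gallai n) (a : Colour) (w x y z : Fin n) : Set where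
  constructor separated
  field
    wx : ¬ Connected G a w x
    wy : ¬ Connected G a w y
    wz : ¬ Connected G a w z
    xy : ¬ Connected G a x y
    xz : ¬ Connected G a x z
    yz : ¬ Connected G a y z

module _ (G : Gallai n) {a : Colour} where

  -- As the component of `x` is a module, the edges at `x` alone determine the colours across the
  -- cut.
  component-cut : ∀ {x y d} → ¬ Connected G a x y → (∀ v → ¬ Connected G a x v → Edge G d x v) → HomogeneousCut G
  component-cut {x} {y} {d} ¬xy crossing-d = record
    { Side = Connected G a x ; side? = connected? G a x ; in-side = x , connected-refl G
    ; off-side = y , ¬xy ; cut-colour = d
    ; cross = λ {u} {v} xu ¬xv → trans (component-module G xu ¬xv) (crossing-d v ¬xv) }

  three-components-cut : ∀ {x y z d} → ¬ Connected G a x y → ¬ Connected G a x z →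
                         (∀ v → ¬ Connected G a x v → Connected G a y v ⊎ Connected G a z v) →
                         Edge G d x y → Edge G d x z → HomogeneousCut G
  three-components-cut {x} {y} {z} {d} ¬xy ¬xz cover dxy dxz = component-cut ¬xy λ v ¬xv → edge (cover v ¬xv)
    where
    edge : ∀ {v} → Connected G a y v ⊎ Connected G a z v → Edge G d x v
    edge (inj₁ yv) = trans (components-uniform G (connected-refl G) yv ¬xy) dxy
    edge (inj₂ zv) = trans (components-uniform G (connected-refl G) zv ¬xz) dxz

  -- With two components, either one is a side. With three, the three colours between them differ
  -- from `a`, so two of them agree, and the component common to those two pairs is a side.
  separated-or-cut : ∀ {x y} → ¬ Connected G a x y →
                     (∃[ w ] ∃[ x ] ∃[ y ] ∃[ z ] Separated G a w x y z) ⊎ HomogeneousCut G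
  separated-or-cut {x} {y} ¬xy =
    third (any? λ z → ¬? (connected? G a x z) ×-dec ¬? (connected? G a y z))
    where
    Result : Set₁
    Result = (∃[ w ] ∃[ x ] ∃[ y ] ∃[ z ] Separated G a w x y z) ⊎ HomogeneousCut G
    module _ {z : Fin n} (¬xz : ¬ Connected G a x z) (¬yz : ¬ Connected G a y z) where
      fourth : Dec (∃[ v ] ¬ Connected G a x v × ¬ Connected G a y v × ¬ Connected G a z v) → Result
      fourth (yes (v , ¬xv , ¬yv , ¬zv)) = inj₁ (x , y , z , v , separated ¬xy ¬xz ¬xv ¬yz ¬yv ¬zv)
      fourth (no none) = inj₂ cut
        where
        x-cover : ∀ v → ¬ Connected G a x v → Connected G a y v ⊎ Connected G a z v
        x-cover v ¬xv with connected? G a y v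
        ... | yes yv = inj₁ yv
        ... | no ¬yv = inj₂ (decidable-stable (connected? G a z v) λ ¬zv → none (v , ¬xv , ¬yv , ¬zv))
        y-cover : ∀ v → ¬ Connected G a y v → Connected G a x v ⊎ Connected G a z v
        y-cover v ¬yv with connected? G a x v
        ... | yes xv = inj₁ xv
        ... | no ¬xv = inj₂ (decidable-stable (connected? G a z v) λ ¬zv → none (v , ¬xv , ¬yv , ¬zv))
        z-cover : ∀ v → ¬ Connected G a z v → Connected G a x v ⊎ Connected G a y v
        z-cover v ¬zv with connected? G a x v
        ... | yes xv = inj₁ xv
        ... | no ¬xv = inj₂ (decidable-stable (connected? G a y v) λ ¬yv → none (v , ¬xv , ¬yv , ¬zv))
        cut : HomogeneousCut G
        cut with crossing G ¬xy | crossing G ¬xz | crossing G ¬yz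
        ... | b , b≢a , bxy | c , c≢a , cxz | d , d≢a , dyz with two-equal a b c d b≢a c≢a d≢a
        ... | inj₁ refl        = three-components-cut ¬xy ¬xz x-cover bxy cxz
        ... | inj₂ (inj₁ refl) = three-components-cut (¬connected-sym G ¬xy) ¬yz y-cover (edge-sym G bxy) dyz
        ... | inj₂ (inj₂ refl) = three-components-cut (¬connected-sym G ¬xz) (¬connected-sym G ¬yz) z-cover
                                   (edge-sym G cxz) (edge-sym G dyz)
    third : Dec (∃[ z ] ¬ Connected G a x z × ¬ Connected G a y z) → Result
    third (yes (z , ¬xz , ¬yz)) = fourth ¬xz ¬yz
      (any? λ v → ¬? (connected? G a x v) ×-dec ¬? (connected? G a y v) ×-dec ¬? (connected? G a z v))
    third (no none) with crossing G ¬xy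
    ... | b , b≢a , bxy = inj₂ (component-cut ¬xy λ v ¬xv → trans
      (components-uniform G (connected-refl G)
        (decidable-stable (connected? G a y v) λ ¬yv → none (v , ¬xv , ¬yv)) ¬xy) bxy)

gallai-structure : (G : Gallai (2 + n)) →
                   (∃[ a ] ∃[ w ] ∃[ x ] ∃[ y ] ∃[ z ] Separated G a w x y z) ⊎ HomogeneousCut G
gallai-structure {n} G with disconnected n G
... | a , _ , _ , ¬xy with separated-or-cut G ¬xy
... | inj₁ sep = inj₁ (a , sep)
... | inj₂ cut = inj₂ cut

-- Degrees and closed neighbourhoods

cover-all : {P Q : Pred (Fin n) 0ℓ} (P? : Decidable P) (Q? : Decidable Q) →
            (∀ i → P i ⊎ Q i) → n ≤ count P? + count Q?
cover-all P? Q? cover = ≤-trans (injective⇒≤count (P? ∪? Q?) id id cover)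
                                (count-cover (P? ∪? Q?) P? Q? (λ _ → id))

count-∪ : {P Q : Pred (Fin n) 0ℓ} (P? : Decidable P) (Q? : Decidable Q) →
          count (P? ∪? Q?) ≤ count P? + count Q?
count-∪ P? Q? = count-cover (P? ∪? Q?) P? Q? (λ _ → id)

1≤count⇒∃ : {P : Pred (Fin n) 0ℓ} (P? : Decidable P) → 1 ≤ count P? → ∃[ x ] P x
1≤count⇒∃ P? 1≤ with choose P? 1≤
... | g , _ , Pg = g zero , Pg zero

module _ (G : Gallai n) where

  degree : Colour → Fin n → ℕ
  degree c x = count (edge? G c x)

  degree-sum : ∀ {a b c} → a ≢ b → a ≢ c → b ≢ c → ∀ x → 1 + degree a x + degree b x + degree c x ≤ n
  degree-sum {a} {b} {c} a≢b a≢c b≢c x = begin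
    1 + degree a x + degree b x + degree c x     ≤⟨ +-monoˡ-≤ _ (+-monoˡ-≤ _ (+-monoˡ-≤ _ (count-singleton x))) ⟩
    count (_≟ x) + degree a x + degree b x + degree c x
      ≤⟨ +-monoˡ-≤ _ (+-monoˡ-≤ _ (count-disjoint (_≟ x) (edge? G a x) λ { _ refl → edge-irrefl G })) ⟩
    count xa? + degree b x + degree c x
      ≤⟨ +-monoˡ-≤ _ (count-disjoint xa? (edge? G b x)
           λ { _ (inj₁ refl) → edge-irrefl G ; _ (inj₂ e) e′ → a≢b (edge-functional G e e′) }) ⟩
    count xab? + degree c x
      ≤⟨ count-disjoint xab? (edge? G c x)
           (λ { _ (inj₁ (inj₁ refl)) → edge-irrefl G ; _ (inj₁ (inj₂ e)) e′ → a≢c (edge-functional G e e′)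
              ; _ (inj₂ e) e′ → b≢c (edge-functional G e e′) }) ⟩
    count (xab? ∪? edge? G c x)                  ≤⟨ count≤n (xab? ∪? edge? G c x) ⟩
    n                                            ∎
    where
    open ≤-Reasoning
    xa? = (_≟ x) ∪? edge? G a x
    xab? = xa? ∪? edge? G b x

  Ball : Colour → Fin n → Pred (Fin n) 0ℓ
  Ball a x = (_≡ x) ∪ Edge G a x

  ball? : ∀ a x → Decidable (Ball a x)
  ball? a x = (_≟ x) ∪? edge? G a x

  degree<ball : ∀ a x → degree a x < count (ball? a x)
  degree<ball a x = ≤-trans (+-monoˡ-≤ _ (count-singleton x))
    (count-disjoint (_≟ x) (edge? G a x) λ { _ refl → edge-irrefl G })

  ball⇒connected : ∀ {a x y} → Ball a x y → Connected G a x y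
  ball⇒connected (inj₁ refl) = connected-refl G
  ball⇒connected (inj₂ e)    = edge⇒connected G e

  components-disjoint : ∀ {a x y i} → ¬ Connected G a x y → Connected G a x i → ¬ Connected G a y i
  components-disjoint ¬xy xi yi = ¬xy (connected-trans G xi (connected-sym G yi))

  balls-disjoint : ∀ {a x y} → ¬ Connected G a x y → ∀ i → Ball a x i → ¬ Ball a y i
  balls-disjoint ¬xy i p q = components-disjoint ¬xy (ball⇒connected p) (ball⇒connected q)

  -- Components are modules, so colour c joins x to the whole components of y and z.
  fan : ∀ {a c x y z} → ¬ Connected G a x y → ¬ Connected G a x z → ¬ Connected G a y z →
        Edge G c x y → Edge G c x z → suc (degree a y) + suc (degree a z) ≤ degree c x
  fan {a} {c} {x} {y} {z} ¬xy ¬xz ¬yz cxy cxz = begin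
    suc (degree a y) + suc (degree a z)        ≤⟨ +-mono-≤ (degree<ball a y) (degree<ball a z) ⟩
    count (ball? a y) + count (ball? a z)      ≤⟨ count-disjoint (ball? a y) (ball? a z) (balls-disjoint ¬yz) ⟩
    count (ball? a y ∪? ball? a z)             ≤⟨ count-mono (ball? a y ∪? ball? a z) (edge? G c x) (λ _ → edge) ⟩
    degree c x                                 ∎
    where
    open ≤-Reasoning
    edge : ∀ {v} → Ball a y v ⊎ Ball a z v → Edge G c x v
    edge (inj₁ p) = trans (components-uniform G (connected-refl G) (ball⇒connected p) ¬xy) cxy
    edge (inj₂ p) = trans (components-uniform G (connected-refl G) (ball⇒connected p) ¬xz) cxz

  -- The balls around `x`, `y`, `z` and the set `P` lie in four different components. `P` is left
  -- general so that it can be the ball around `w` or that ball with one further vertex.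
  separated-counts : ∀ {a w x y z} → Separated G a w x y z →
                     {P : Pred (Fin n) 0ℓ} (P? : Decidable P) → (∀ i → P i → Connected G a w i) →
                     count P? + suc (degree a x) + suc (degree a y) + suc (degree a z) ≤ n
  separated-counts {a} {w} {x} {y} {z} sep P? P⊆ = begin
    count P? + suc (degree a x) + suc (degree a y) + suc (degree a z)
      ≤⟨ +-mono-≤ (+-mono-≤ (+-monoʳ-≤ _ (degree<ball a x)) (degree<ball a y)) (degree<ball a z) ⟩
    count P? + count (ball? a x) + count (ball? a y) + count (ball? a z)
      ≤⟨ +-monoˡ-≤ _ (+-monoˡ-≤ _ (count-disjoint P? (ball? a x)
           λ i p q → components-disjoint wx (P⊆ i p) (ball⇒connected q))) ⟩
    count Px? + count (ball? a y) + count (ball? a z)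
      ≤⟨ +-monoˡ-≤ _ (count-disjoint Px? (ball? a y)
           λ { i (inj₁ p) q → components-disjoint wy (P⊆ i p) (ball⇒connected q) ; i (inj₂ p) → balls-disjoint xy i p }) ⟩
    count Pxy? + count (ball? a z)
      ≤⟨ count-disjoint Pxy? (ball? a z)
           (λ { i (inj₁ (inj₁ p)) q → components-disjoint wz (P⊆ i p) (ball⇒connected q)
              ; i (inj₁ (inj₂ p)) → balls-disjoint xz i p ; i (inj₂ p) → balls-disjoint yz i p }) ⟩
    count (Pxy? ∪? ball? a z)                  ≤⟨ count≤n (Pxy? ∪? ball? a z) ⟩
    n                                          ∎
    where
    open ≤-Reasoning
    open Separated sep
    Px? = P? ∪? ball? a x
    Pxy? = Px? ∪? ball? a y

  separated-degrees : ∀ {a w x y z} → Separated G a w x y z →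
    suc (degree a w) + suc (degree a x) + suc (degree a y) + suc (degree a z) ≤ n
  separated-degrees {a} {w} sep = ≤-trans
    (+-monoˡ-≤ _ (+-monoˡ-≤ _ (+-monoˡ-≤ _ (degree<ball a w))))
    (separated-counts sep (ball? a w) λ _ → ball⇒connected)

  -- Two of the three edges from w to x, y, z share their colour.
  separated-fan : ∀ {a w x y z} → Separated G a w x y z →
    ∃[ c ] c ≢ a × ∃[ u ] ∃[ v ] ¬ Connected G a w u × ¬ Connected G a w v × ¬ Connected G a u v ×
      suc (degree a u) + suc (degree a v) ≤ degree c w
  separated-fan {a} {w} {x} {y} {z} (separated wx wy wz xy xz yz)
    with crossing G wx | crossing G wy | crossing G wz
  ... | b , b≢a , ex | c , c≢a , ey | d , d≢a , ez with two-equal a b c d b≢a c≢a d≢a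
  ... | inj₁ refl        = b , b≢a , x , y , wx , wy , xy , fan wx wy xy ex ey
  ... | inj₂ (inj₁ refl) = b , b≢a , x , z , wx , wz , xz , fan wx wz xz ex ez
  ... | inj₂ (inj₂ refl) = c , c≢a , y , z , wy , wz , yz , fan wy wz yz ey ez

-- The upper bound

-- These hypotheses describe what remains of a colouring of order at most 12 after deleting a vertex
-- all of whose edges have colour `d`.
module _ {k : ℕ} (order≤11 : 2 + k ≤ 11) (G : Gallai (2 + k)) (d : Colour)
         (big : ∀ {c} → c ≢ d → ∀ y → 4 ≤ degree G c y)
         (spread : ∀ {y z} → y ≢ z → ¬ Edge G d y z → 3 ≤ degree G d y + degree G d z) where

  private
    ¬12≤order : ¬ 12 ≤ 2 + k
    ¬12≤order 12≤ = toWitnessFalse {a? = 12 ≤? 11} tt (≤-trans 12≤ order≤11)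

    -- For `x` and `y` on opposite sides, the neighbourhoods in the cut colour `e` cover all `2 + k`
    -- vertices. A colour `b` other than `e` and `d` adds at least 4 at each of `x` and `y`, and the
    -- remaining colour `c` at least 3 in total, too much for the two degree sums.
    no-cut : ¬ HomogeneousCut G
    no-cut C = absurd (rest-large (cut-colour ≟ d))
      where
      open HomogeneousCut C
      open ≤-Reasoning
      e = cut-colour
      x = proj₁ in-side
      y = proj₁ off-side
      exy : Edge G e x y
      exy = cross (proj₂ in-side) (proj₂ off-side)
      e-large : 2 + k ≤ degree G e x + degree G e y
      e-large = cover-all (edge? G e x) (edge? G e y) λ v → covered (side? v)
        where
        covered : ∀ {v} → Dec (Side v) → Edge G e x v ⊎ Edge G e y v
        covered (yes s) = inj₂ (edge-sym G (cross s (proj₂ off-side)))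
        covered (no ¬s) = inj₁ (cross (proj₂ in-side) ¬s)
      b = proj₁ (third-colour e d)
      b≢e = proj₁ (proj₂ (third-colour e d))
      b≢d = proj₂ (proj₂ (third-colour e d))
      absurd : ∃[ c ] c ≢ e × c ≢ b × 3 ≤ degree G c x + degree G c y → ⊥
      absurd (c , c≢e , c≢b , 3≤) = ¬12≤order (+-cancelʳ-≤ (2 + k) 12 (2 + k) (begin
        12 + (2 + k)  ≤⟨ +-monoʳ-≤ 12 e-large ⟩
        12 + (degree G e x + degree G e y)
          ≤⟨ ≤-trans (n≤1+n _) (+-monoˡ-≤ _ (+-monoʳ-≤ 2 (+-mono-≤ (+-mono-≤ (big b≢d x) (big b≢d y)) 3≤))) ⟩
        2 + ((degree G b x + degree G b y) + (degree G c x + degree G c y)) + (degree G e x + degree G e y)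
          ≡⟨ rearrange (degree G b x) (degree G b y) (degree G c x) (degree G c y) (degree G e x) (degree G e y) ⟩
        (1 + degree G b x + degree G c x + degree G e x) + (1 + degree G b y + degree G c y + degree G e y)
          ≤⟨ +-mono-≤ (degree-sum G (≢-sym c≢b) b≢e c≢e x) (degree-sum G (≢-sym c≢b) b≢e c≢e y) ⟩
        (2 + k) + (2 + k) ∎))
        where
        rearrange : ∀ p q r s t u → 2 + ((p + q) + (r + s)) + (t + u) ≡ (1 + p + r + t) + (1 + q + s + u)
        rearrange = solve-∀
      -- If `d` is not the cut colour, it is the remaining colour and `spread` applies to `xy`;
      -- otherwise `big` applies to the remaining colour.
      rest-large : Dec (e ≡ d) → ∃[ c ] c ≢ e × c ≢ b × 3 ≤ degree G c x + degree G c y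
      rest-large (no e≢d) = d , ≢-sym e≢d , ≢-sym b≢d , spread (edge⇒≢ G exy)
        λ dxy → e≢d (edge-functional G exy dxy)
      rest-large (yes e≡d) with third-colour e b
      ... | c , c≢e , c≢b = c , c≢e , c≢b , ≤-trans (n≤1+n 3) (≤-trans (big (subst (c ≢_) e≡d c≢e) x) (m≤m+n _ _))

    -- Counting `w`, 2 neighbours in `d`, 4 in `b`, and 5 in the fan colour `c` gives 12 vertices.
    -- The 5 comes from two balls whose degrees add up to at least 3.
    no-balanced : ∀ {w x y z} → Separated G d w x y z → ¬ 2 ≤ degree G d w
    no-balanced {w} sep 2≤ with separated-fan G sep
    ... | c , c≢d , u , v , ¬wu , ¬wv , ¬uv , fan≤ with third-colour d c
    ... | b , b≢d , b≢c = ¬12≤order (≤-trans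
      (+-mono-≤ (+-mono-≤ (+-monoʳ-≤ 1 2≤) (big b≢d w)) (≤-trans
        (≤-trans (+-monoʳ-≤ 2 (spread (¬connected⇒≢ G ¬uv) λ e → ¬uv (edge⇒connected G e)))
                 (≤-reflexive (cong suc (sym (+-suc _ _))))) fan≤))
      (degree-sum G (≢-sym b≢d) (≢-sym c≢d) b≢c w))

    -- If `a` is not `d`, four disjoint balls of at least 5 vertices need 20. If it is, the
    -- `d`-degrees of `w` and `x` add up to at least 3, so one of them is at least 2 and
    -- `no-balanced` applies there.
    no-separated : ∀ a {w x y z} → ¬ Separated G a w x y z
    no-separated a {w} {x} {y} {z} sep with a ≟ d
    ... | no a≢d = ¬12≤order (≤-trans (m≤m+n 12 8) (≤-trans
      (+-mono-≤ (+-mono-≤ (+-mono-≤ (s≤s (big a≢d w)) (s≤s (big a≢d x))) (s≤s (big a≢d y))) (s≤s (big a≢d z)))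
      (separated-degrees G sep)))
    ... | yes refl with 2 ≤? degree G a w | 2 ≤? degree G a x
    ... | yes 2≤ | _ = no-balanced sep 2≤
    ... | no _ | yes 2≤ = no-balanced (separated (¬connected-sym G wx) xy xz wy wz yz) 2≤
      where open Separated sep
    ... | no ≰w | no ≰x = toWitnessFalse {a? = 3 ≤? 2} tt (≤-trans
      (spread (¬connected⇒≢ G wx) λ e → wx (edge⇒connected G e))
      (+-mono-≤ (s≤s⁻¹ (≰⇒> ≰w)) (s≤s⁻¹ (≰⇒> ≰x))))
      where open Separated sep

  no-dominated : ⊥
  no-dominated = [ (λ (a , _ , _ , _ , _ , sep) → no-separated a sep) , no-cut ]′ (gallai-structure G)

-- In K₁₂, a 2-coloured B₇ with spine xy avoiding c exists unless at least 4 vertices are joined by c to x or y.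
Spread : Gallai n → Set
Spread G = ∀ {c x y} → x ≢ y → ¬ Edge G c x y → 4 ≤ count (edge? G c x ∪? edge? G c y)

module _ {k : ℕ} (order≤12 : 3 + k ≤ 12) (G : Gallai (3 + k)) (spread : Spread G) where

  private
    ¬13≤order : ¬ 13 ≤ 3 + k
    ¬13≤order 13≤ = toWitnessFalse {a? = 13 ≤? 12} tt (≤-trans 13≤ order≤12)

  -- The vertex `v` is deleted. For `c` other than `d` it has no `c`-neighbours, so the four that
  -- `spread` gives to `v` and `y` all belong to `y`. In colour `d` the deletion costs at most one
  -- of the four neighbours, which leaves 3.
  no-monochromatic-vertex : ∀ {v d} → ¬ (∀ u → u ≢ v → Edge G d v u)
  no-monochromatic-vertex {v} {d} all-d = no-dominated (s≤s⁻¹ order≤12) G′ d big spread′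
    where
    G′ = restrict (punchIn v) (punchIn-injective v _ _) G
    big : ∀ {c} → c ≢ d → ∀ y → 4 ≤ degree G′ c y
    big {c} c≢d y = begin
      4                                              ≤⟨ spread (≢-sym (punchInᵢ≢i v y)) (¬cv (punchIn v y)) ⟩
      count (edge? G c v ∪? edge? G c (punchIn v y)) ≤⟨ count-mono (edge? G c v ∪? edge? G c (punchIn v y)) (edge? G c (punchIn v y))
                                                          (λ { i (inj₁ e) → contradiction e (¬cv i) ; _ (inj₂ e) → e }) ⟩
      count (edge? G c (punchIn v y))                ≤⟨ count-punchIn-∉ (edge? G c (punchIn v y)) v (¬cv (punchIn v y) ∘ edge-sym G) ⟩
      degree G′ c y                                  ∎
      where
      open ≤-Reasoning
      ¬cv : ∀ i → ¬ Edge G c v i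
      ¬cv i e = c≢d (edge-functional G e (all-d i (≢-sym (edge⇒≢ G e))))
    spread′ : ∀ {y z} → y ≢ z → ¬ Edge G′ d y z → 3 ≤ degree G′ d y + degree G′ d z
    spread′ {y} {z} y≢z ¬e = s≤s⁻¹ (begin
      4                                        ≤⟨ spread (y≢z ∘ punchIn-injective v y z) ¬e ⟩
      count yz?                                ≤⟨ count-punchIn yz? v ⟩
      suc (count (yz? ∘ punchIn v))            ≤⟨ s≤s (count-∪ (edge? G′ d y) (edge? G′ d z)) ⟩
      suc (degree G′ d y + degree G′ d z)      ∎)
      where
      open ≤-Reasoning
      yz? = edge? G d (punchIn v y) ∪? edge? G d (punchIn v z)

  private
    degree-pair : ∀ {c x y} → x ≢ y → ¬ Edge G c x y → 4 ≤ degree G c x + degree G c y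
    degree-pair {c} {x} {y} x≢y ¬e = ≤-trans (spread x≢y ¬e) (count-∪ (edge? G c x) (edge? G c y))

    component-pair : ∀ {a x y} → ¬ Connected G a x y → 4 ≤ degree G a x + degree G a y
    component-pair ¬xy = degree-pair (¬connected⇒≢ G ¬xy) (¬xy ∘ edge⇒connected G)

    -- The four closed neighbourhoods already account for 12 vertices.
    component-clique : ∀ {a w x y z u} → Separated G a w x y z → Connected G a w u → u ≢ w → Edge G a w u
    component-clique {a} {w} {x} {y} {z} {u} sep wu u≢w = decidable-stable (edge? G a w u) λ ¬e →
      ¬13≤order (begin
        13  ≤⟨ +-monoʳ-≤ 5 (+-mono-≤ (component-pair wx) (component-pair yz)) ⟩
        5 + ((degree G a w + degree G a x) + (degree G a y + degree G a z))
          ≡⟨ rearrange (degree G a w) (degree G a x) (degree G a y) (degree G a z) ⟩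
        (suc (degree G a w) + 1) + suc (degree G a x) + suc (degree G a y) + suc (degree G a z)
          ≤⟨ +-monoˡ-≤ _ (+-monoˡ-≤ _ (+-monoˡ-≤ _ (enlarged ¬e))) ⟩
        count B? + suc (degree G a x) + suc (degree G a y) + suc (degree G a z)
          ≤⟨ separated-counts G sep B? (λ { _ (inj₁ p) → ball⇒connected G p ; _ (inj₂ refl) → wu }) ⟩
        3 + k ∎)
      where
      open ≤-Reasoning
      open Separated sep
      B? = ball? G a w ∪? (_≟ u)
      enlarged : ¬ Edge G a w u → suc (degree G a w) + 1 ≤ count B?
      enlarged ¬e = ≤-trans (+-mono-≤ (degree<ball G a w) (count-singleton u))
        (count-disjoint (ball? G a w) (_≟ u) λ { _ (inj₁ refl) w≡u → u≢w (sym w≡u) ; _ (inj₂ e) refl → ¬e e })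
      rearrange : ∀ p q r s → 5 + ((p + q) + (r + s)) ≡ (suc p + 1) + suc q + suc r + suc s
      rearrange = solve-∀

    -- If `w` had no `a`-neighbour, each of `x`, `y`, `z` would have at least four, and the four
    -- balls would hold 1 + 5 + 5 + 5 vertices.
    component-nontrivial : ∀ {a w x y z} → Separated G a w x y z → 1 ≤ degree G a w
    component-nontrivial {a} {w} {x} {y} {z} sep = ≮⇒≥ λ isolated → ¬13≤order (begin
        13                         ≤⟨ m≤m+n 13 3 ⟩
        1 + 5 + 5 + 5              ≤⟨ +-mono-≤ (+-mono-≤ (+-mono-≤ (m≤m+n 1 (degree G a w)) (s≤s (≥4 isolated wx)))
                                        (s≤s (≥4 isolated wy))) (s≤s (≥4 isolated wz)) ⟩
        suc (degree G a w) + suc (degree G a x) + suc (degree G a y) + suc (degree G a z)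
                                   ≤⟨ separated-degrees G sep ⟩
        3 + k                      ∎)
      where
      open ≤-Reasoning
      open Separated sep
      ≥4 : ∀ {v} → degree G a w < 1 → ¬ Connected G a w v → 4 ≤ degree G a v
      ≥4 {v} isolated ¬wv = ≤-trans (component-pair ¬wv) (+-monoˡ-≤ (degree G a v) (s≤s⁻¹ isolated))

    -- For an `a`-neighbour `u` of `w`, `spread` gives four vertices joined by `b` to `w` or `u`.
    -- Since the component is an `a`-clique, those joined to `u` lie outside it, so by the module
    -- property they are joined by `b` to `w` too.
    outer-degree : ∀ {a b w x y z} → Separated G a w x y z → b ≢ a → 4 ≤ degree G b w
    outer-degree {a} {b} {w} sep b≢a with 1≤count⇒∃ (edge? G a w) (component-nontrivial sep)
    ... | u , wu = ≤-trans
      (spread (edge⇒≢ G wu) λ e → b≢a (edge-functional G e wu))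
      (count-mono (edge? G b w ∪? edge? G b u) (edge? G b w) λ { _ (inj₁ e) → e ; v (inj₂ e) → transfer v e })
      where
      open Separated sep
      w⇝u : Connected G a w u
      w⇝u = edge⇒connected G wu
      sep-u : Separated G a u _ _ _
      sep-u = separated (wx ∘ connected-trans G w⇝u) (wy ∘ connected-trans G w⇝u) (wz ∘ connected-trans G w⇝u) xy xz yz
      transfer : ∀ v → Edge G b u v → Edge G b w v
      transfer v e = trans (sym (component-module G w⇝u λ wv → b≢a (edge-functional G e
        (component-clique sep-u (connected-trans G (connected-sym G w⇝u) wv) (≢-sym (edge⇒≢ G e)))))) e

  no-four-components : ∀ {a w x y z} → ¬ Separated G a w x y z
  no-four-components {a} {w} sep with separated-fan G sep
  ... | c , c≢a , u , v , ¬wu , ¬wv , ¬uv , fan≤ with third-colour a c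
  -- The degree sum at `w` gives `p + q + r` at most 5, while the three pairwise sums are each at
  -- least 4. The count is doubled to avoid halving.
  ... | b , b≢a , b≢c = toWitnessFalse {a? = 26 ≤? 24} tt (begin
    26  ≤⟨ +-monoʳ-≤ 14 (+-mono-≤ (+-mono-≤ (component-pair ¬wu) (component-pair ¬wv)) (component-pair ¬uv)) ⟩
    14 + ((p + q) + (p + r) + (q + r))  ≡⟨ rearrange p q r ⟩
    (1 + p + 4 + (suc q + suc r)) + (1 + p + 4 + (suc q + suc r))  ≤⟨ +-mono-≤ total total ⟩
    24  ∎)
    where
    open ≤-Reasoning
    p = degree G a w
    q = degree G a u
    r = degree G a v
    total : 1 + p + 4 + (suc q + suc r) ≤ 12
    total = ≤-trans (+-mono-≤ (+-monoʳ-≤ (1 + p) (outer-degree sep b≢a)) fan≤)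
      (≤-trans (degree-sum G (≢-sym b≢a) (≢-sym c≢a) b≢c w) order≤12)
    rearrange : ∀ p q r → 14 + ((p + q) + (p + r) + (q + r)) ≡ (1 + p + 4 + (suc q + suc r)) + (1 + p + 4 + (suc q + suc r))
    rearrange = solve-∀

  module _ (C : HomogeneousCut G) (small : count (HomogeneousCut.side? C) ≤ 6) where

    private
      open HomogeneousCut C renaming (cut-colour to d)

      ¬7≤side : ¬ 7 ≤ count side?
      ¬7≤side 7≤ = toWitnessFalse {a? = 7 ≤? 6} tt (≤-trans 7≤ small)

      stays : ∀ {c x y} → c ≢ d → Side x → Edge G c x y → Side y
      stays {y = y} c≢d sx e = decidable-stable (side? y) λ ¬sy → c≢d (edge-functional G e (cross sx ¬sy))

      stays-∪ : ∀ {c x y} → c ≢ d → Side x → Side y → ∀ i → Edge G c x i ⊎ Edge G c y i → Side i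
      stays-∪ c≢d sx sy i (inj₁ e) = stays c≢d sx e
      stays-∪ c≢d sx sy i (inj₂ e) = stays c≢d sy e

      -- Each of the two colours other than `d` joins at least 4 vertices to `x` or `y`, all within
      -- the side. No vertex is counted for both colours, or it would form a rainbow triangle with
      -- `xy` or have an edge of two colours. So the side would have 8 vertices.
      no-cut-coloured-edge : ∀ {x y} → Side x → Side y → ¬ Edge G d x y
      no-cut-coloured-edge {x} {y} sx sy dxy = ¬7≤side (begin
        7                     ≤⟨ n≤1+n 7 ⟩
        4 + 4                 ≤⟨ +-mono-≤ (nbrs b≢d) (nbrs c≢d) ⟩
        count B? + count C?   ≤⟨ count-disjoint B? C? disjoint ⟩
        count (B? ∪? C?)      ≤⟨ count-mono (B? ∪? C?) side?
                                   (λ { i (inj₁ p) → stays-∪ b≢d sx sy i p ; i (inj₂ p) → stays-∪ c≢d sx sy i p }) ⟩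
        count side?           ∎)
        where
        open ≤-Reasoning
        b = proj₁ (third-colour d d)
        b≢d = proj₁ (proj₂ (third-colour d d))
        c = proj₁ (third-colour d b)
        c≢d = proj₁ (proj₂ (third-colour d b))
        c≢b = proj₂ (proj₂ (third-colour d b))
        B? = edge? G b x ∪? edge? G b y
        C? = edge? G c x ∪? edge? G c y
        nbrs : ∀ {e} → e ≢ d → 4 ≤ count (edge? G e x ∪? edge? G e y)
        nbrs e≢d = spread (edge⇒≢ G dxy) λ e → e≢d (edge-functional G e dxy)
        rainbow : ∀ {p q i} → p ≢ d → q ≢ d → p ≢ q → Edge G p x i → ¬ Edge G q y i
        rainbow p≢d q≢d p≢q xi yi with no-rainbow G dxy xi yi
        ... | inj₁ d≡p        = p≢d (sym d≡p)
        ... | inj₂ (inj₁ d≡q) = q≢d (sym d≡q)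
        ... | inj₂ (inj₂ p≡q) = p≢q p≡q
        disjoint : ∀ i → Edge G b x i ⊎ Edge G b y i → ¬ (Edge G c x i ⊎ Edge G c y i)
        disjoint i (inj₁ p) (inj₁ q) = c≢b (edge-functional G q p)
        disjoint i (inj₁ p) (inj₂ q) = rainbow b≢d c≢d (≢-sym c≢b) p q
        disjoint i (inj₂ p) (inj₁ q) = rainbow c≢d b≢d c≢b q p
        disjoint i (inj₂ p) (inj₂ q) = c≢b (edge-functional G q p)

      -- The third colour `b` joins at least 4 vertices of the side to `x` or `y`; none is a vertex
      -- of the triangle, whose edges have colour `c`. So the side would have 7 vertices.
      no-triangle : ∀ {c x y z} → c ≢ d → Side x → Edge G c x y → Edge G c x z → ¬ Edge G c y z
      no-triangle {c} {x} {y} {z} c≢d sx xy xz yz = ¬7≤side (begin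
        1 + 1 + 1 + 4
          ≤⟨ +-mono-≤ (+-mono-≤ (+-mono-≤ (count-singleton x) (count-singleton y)) (count-singleton z))
               (spread (edge⇒≢ G xy) λ e → b≢c (edge-functional G e xy)) ⟩
        count (_≟ x) + count (_≟ y) + count (_≟ z) + count B?
          ≤⟨ +-monoˡ-≤ _ (+-monoˡ-≤ _ (count-disjoint (_≟ x) (_≟ y) λ { _ refl x≡y → edge⇒≢ G xy x≡y })) ⟩
        count xy? + count (_≟ z) + count B?
          ≤⟨ +-monoˡ-≤ _ (count-disjoint xy? (_≟ z)
               λ { _ (inj₁ refl) x≡z → edge⇒≢ G xz x≡z ; _ (inj₂ refl) y≡z → edge⇒≢ G yz y≡z }) ⟩
        count xyz? + count B?
          ≤⟨ count-disjoint xyz? B? disjoint ⟩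
        count (xyz? ∪? B?)
          ≤⟨ count-mono (xyz? ∪? B?) side?
               (λ { _ (inj₁ (inj₁ (inj₁ refl))) → sx ; _ (inj₁ (inj₁ (inj₂ refl))) → sy
                  ; _ (inj₁ (inj₂ refl)) → stays c≢d sx xz ; i (inj₂ p) → stays-∪ b≢d sx sy i p }) ⟩
        count side? ∎)
        where
        open ≤-Reasoning
        sy = stays c≢d sx xy
        b = proj₁ (third-colour d c)
        b≢d = proj₁ (proj₂ (third-colour d c))
        b≢c = proj₂ (proj₂ (third-colour d c))
        B? = edge? G b x ∪? edge? G b y
        xy? = (_≟ x) ∪? (_≟ y)
        xyz? = xy? ∪? (_≟ z)
        disjoint : ∀ i → ((i ≡ x ⊎ i ≡ y) ⊎ i ≡ z) → ¬ (Edge G b x i ⊎ Edge G b y i)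
        disjoint _ (inj₁ (inj₁ refl)) (inj₁ e) = edge-irrefl G e
        disjoint _ (inj₁ (inj₁ refl)) (inj₂ e) = b≢c (edge-functional G (edge-sym G e) xy)
        disjoint _ (inj₁ (inj₂ refl)) (inj₁ e) = b≢c (edge-functional G e xy)
        disjoint _ (inj₁ (inj₂ refl)) (inj₂ e) = edge-irrefl G e
        disjoint _ (inj₂ refl) (inj₁ e) = b≢c (edge-functional G e xz)
        disjoint _ (inj₂ refl) (inj₂ e) = b≢c (edge-functional G e yz)

      -- The argument for R(3,3) ≤ 6.
      no-star : ∀ {c x} → c ≢ d → Side x → ¬ 3 ≤ degree G c x
      no-star {c} {x} c≢d sx 3≤ with choose (edge? G c x) 3≤
      ... | g , g-inj , e = no-triangle b≢d (side zero) (b-edge zero (suc zero) (λ ()))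
                              (b-edge zero (suc (suc zero)) (λ ())) (b-edge (suc zero) (suc (suc zero)) (λ ()))
        where
        b = proj₁ (third-colour d c)
        b≢d = proj₁ (proj₂ (third-colour d c))
        b≢c = proj₂ (proj₂ (third-colour d c))
        side : ∀ i → Side (g i)
        side i = stays c≢d sx (e i)
        b-edge : ∀ i j → i ≢ j → Edge G b (g i) (g j)
        b-edge i j i≢j with col-off G (i≢j ∘ g-inj)
        ... | q , f = subst (λ q → Edge G q (g i) (g j)) (sym (third-unique c≢d b≢d q≢d b≢c q≢c)) f
          where
          q≢d : q ≢ d
          q≢d refl = no-cut-coloured-edge (side i) (side j) f
          q≢c : q ≢ c
          q≢c refl = no-triangle c≢d sx (e i) (e j) f

    no-small-side : ⊥
    no-small-side = by-neighbour (any? λ y → ¬? (y ≟ x) ×-dec ¬? (edge? G d x y))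
      where
      x = proj₁ in-side
      sx = proj₂ in-side
      by-neighbour : Dec (∃[ y ] y ≢ x × ¬ Edge G d x y) → ⊥
      by-neighbour (no none) = no-monochromatic-vertex {x} {d} λ y y≢x →
        decidable-stable (edge? G d x y) λ ¬e → none (y , y≢x , ¬e)
      by-neighbour (yes (y , y≢x , ¬dxy)) with col-off G (≢-sym y≢x)
      ... | c , cxy = by-degree (3 ≤? degree G c x)
        where
        open ≤-Reasoning
        c≢d : c ≢ d
        c≢d refl = ¬dxy cxy
        b = proj₁ (third-colour d c)
        b≢d = proj₁ (proj₂ (third-colour d c))
        b≢c = proj₂ (proj₂ (third-colour d c))
        sy = stays c≢d sx cxy
        B? = edge? G b x ∪? edge? G b y
        -- A `b`-neighbour of `y` lies in the side, where no edge has colour `d`, so its edge to `x`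
        -- has colour `b` or `c`.
        nbr : ∀ i → i ≡ y ⊎ Edge G b x i ⊎ Edge G b y i → Edge G c x i ⊎ Edge G b x i
        nbr _ (inj₁ refl)     = inj₁ cxy
        nbr _ (inj₂ (inj₁ e)) = inj₂ e
        nbr i (inj₂ (inj₂ e)) with col-off G {x} {i} (λ { refl → b≢c (edge-functional G (edge-sym G e) cxy) })
        ... | q , xi with q ≟ c
        ... | yes refl = inj₁ xi
        ... | no q≢c = inj₂ (subst (λ q → Edge G q x i) (third-unique c≢d q≢d b≢d q≢c b≢c) xi)
          where
          q≢d : q ≢ d
          q≢d refl = no-cut-coloured-edge sx (stays b≢d sy e) xi
        -- The vertex `y` and the four vertices joined by `b` to `x` or `y` make five neighbours of
        -- `x` in colours `b` and `c`, so one of these colours has a star of three edges at `x`.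
        5≤ : 5 ≤ degree G c x + degree G b x
        5≤ = begin
          1 + 4                        ≤⟨ +-mono-≤ (count-singleton y) (spread (≢-sym y≢x) λ e → b≢c (edge-functional G e cxy)) ⟩
          count (_≟ y) + count B?      ≤⟨ count-disjoint (_≟ y) B? (λ { _ refl (inj₁ e) → b≢c (edge-functional G e cxy)
                                                                      ; _ refl (inj₂ e) → edge-irrefl G e }) ⟩
          count ((_≟ y) ∪? B?)         ≤⟨ count-cover ((_≟ y) ∪? B?) (edge? G c x) (edge? G b x) nbr ⟩
          degree G c x + degree G b x  ∎
        by-degree : Dec (3 ≤ degree G c x) → ⊥
        by-degree (yes 3≤) = no-star c≢d sx 3≤
        by-degree (no ≰3) = no-star b≢d sx (+-cancelˡ-≤ 2 3 (degree G b x)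
          (≤-trans 5≤ (+-monoˡ-≤ (degree G b x) (s≤s⁻¹ (≰⇒> ≰3)))))

  no-homogeneous-cut : ¬ HomogeneousCut G
  no-homogeneous-cut C = by-size (count side? ≤? 6)
    where
    open HomogeneousCut C
    off? : Decidable (λ u → ¬ Side u)
    off? u = ¬? (side? u)
    by-size : Dec (count side? ≤ 6) → ⊥
    by-size (yes small) = no-small-side C small
    -- Seven vertices on one side leave at most five for the other.
    by-size (no large) = no-small-side (other-side C) (+-cancelˡ-≤ 6 (count off?) 6 (begin
      6 + count off?              ≤⟨ n≤1+n _ ⟩
      7 + count off?              ≤⟨ +-monoˡ-≤ _ (≰⇒> large) ⟩
      count side? + count off?    ≤⟨ count-disjoint side? off? (λ _ s ¬s → ¬s s) ⟩
      count (side? ∪? off?)       ≤⟨ count≤n (side? ∪? off?) ⟩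
      3 + k                       ≤⟨ order≤12 ⟩
      12                          ∎))
      where open ≤-Reasoning

  ¬spread : ⊥
  ¬spread = [ (λ (_ , _ , _ , _ , _ , sep) → no-four-components sep) , no-homogeneous-cut ]′ (gallai-structure G)

-- From colourings to matrices and from pages to books

embedding⇒copy : ∀ {G} (g : Vertex G → Fin n) → Injective _≡_ _≡_ g → Copy G (K n)
embedding⇒copy {G = G} g g-inj = record
  { embed = g ; injective = g-inj
  ; preserves = λ {u} e eq → Graph.irrefl G (subst (Adj G u) (sym (g-inj eq)) e) }

page : Fin 7 → Vertex (Book 7)
page = inj₂

spine : Fin 2 → Vertex (Book 7)
spine = inj₁

-- Two colours out of three are all colours but one.
avoided-colour : (S : Subset 3) → ∣ S ∣ ≤ 2 → ∃[ c ] c ∉ S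
avoided-colour (false ∷ _)                        _ = zero , λ ()
avoided-colour (true ∷ false ∷ _)                 _ = suc zero , λ { (there ()) }
avoided-colour (true ∷ true ∷ false ∷ [])         _ = suc (suc zero) , λ { (there (there ())) }
avoided-colour (true ∷ true ∷ true ∷ [])          (s≤s (s≤s ()))

size-∁ : (c : Colour) → ∣ ∁ ⁅ c ⁆ ∣ ≤ 2
size-∁ = toWitness {a? = all? λ c → ∣ ∁ ⁅ c ⁆ ∣ ≤? 2} tt

module _ (f : Colouring 3 (K n)) (gallai : IsGallai f) where

  private
    -- The decision is an argument so that the lemmas about the matrix can match on it directly.
    entry : ∀ {x y : Fin n} → Dec (x ≡ y) → Maybe Colour
    entry (yes _)           = nothing
    entry {x} {y} (no x≢y) = just (colour f x y x≢y)

    entry-colour : ∀ {x y} (x≟y : Dec (x ≡ y)) (x≢y : x ≢ y) → entry x≟y ≡ just (colour f x y x≢y)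
    entry-colour (yes x≡y) x≢y = contradiction x≡y x≢y
    entry-colour (no _)    _   = refl

    entry-sym : ∀ {x y} (x≟y : Dec (x ≡ y)) (y≟x : Dec (y ≡ x)) → entry x≟y ≡ entry y≟x
    entry-sym (yes _)   (yes _)   = refl
    entry-sym (yes x≡y) (no y≢x)  = contradiction (sym x≡y) y≢x
    entry-sym (no x≢y)  (yes y≡x) = contradiction (sym y≡x) x≢y
    entry-sym {x} {y} (no x≢y) (no _) = cong just (Colouring.symmetric f x y x≢y)

    entry-diag : ∀ {x} (x≟x : Dec (x ≡ x)) → entry x≟x ≡ nothing
    entry-diag (yes _)  = refl
    entry-diag (no x≢x) = contradiction refl x≢x

    entry-just : ∀ {x y c} (x≟y : Dec (x ≡ y)) → entry x≟y ≡ just c → ∃[ x≢y ] colour f x y x≢y ≡ c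
    entry-just (no x≢y) eq = x≢y , just-injective eq

    matrix-no-rainbow : ∀ {x y z a b c} → entry (x ≟ y) ≡ just a → entry (x ≟ z) ≡ just b → entry (y ≟ z) ≡ just c →
                        a ≡ b ⊎ a ≡ c ⊎ b ≡ c
    matrix-no-rainbow {x} {y} {z} {a} {b} {c} p q r
      with entry-just (x ≟ y) p | entry-just (x ≟ z) q | entry-just (y ≟ z) r
    ... | xy , refl | xz , refl | yz , refl = decidable-stable (a ≟ b ⊎-dec a ≟ c ⊎-dec b ≟ c)
      λ ¬two → gallai x y z xy xz yz (¬two ∘ inj₁ , ¬two ∘ inj₂ ∘ inj₁ , ¬two ∘ inj₂ ∘ inj₂)

  matrix : Gallai n
  matrix = record
    { col = λ x y → entry (x ≟ y) ; col-sym = λ x y → entry-sym (x ≟ y) (y ≟ x) ; col-diag = λ x → entry-diag (x ≟ x)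
    ; col-off = λ {x} {y} x≢y → colour f x y x≢y , entry-colour (x ≟ y) x≢y ; no-rainbow = matrix-no-rainbow }

  matrix-edge : ∀ {c x y} (x≢y : x ≢ y) → colour f x y x≢y ≡ c → Edge matrix c x y
  matrix-edge {x = x} {y} x≢y eq = trans (entry-colour (x ≟ y) x≢y) (cong just eq)

module _ (G : Gallai n) where

  Page : Colour → Fin n → Fin n → Pred (Fin n) 0ℓ
  Page c x y z = (z ≢ x × z ≢ y) × ¬ Edge G c x z × ¬ Edge G c y z

  page? : ∀ c x y → Decidable (Page c x y)
  page? c x y z = (¬? (z ≟ x) ×-dec ¬? (z ≟ y)) ×-dec ¬? (edge? G c x z) ×-dec ¬? (edge? G c y z)

  WideBook : Set
  WideBook = ∃[ c ] ∃[ x ] ∃[ y ] (x ≢ y × ¬ Edge G c x y) × 7 ≤ count (page? c x y)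

  -- Decidability lets the upper bound be proved by refuting the absence of such a book.
  wideBook? : Dec WideBook
  wideBook? = any? λ c → any? λ x → any? λ y → (¬? (x ≟ y) ×-dec ¬? (edge? G c x y)) ×-dec 7 ≤? count (page? c x y)

  vertices≤pages+neighbours : ∀ c x y → n ≤ count (page? c x y) + (2 + count (edge? G c x ∪? edge? G c y))
  vertices≤pages+neighbours c x y = begin
    n                                            ≤⟨ cover-all (page? c x y) xyB? cover ⟩
    count (page? c x y) + count xyB?             ≤⟨ +-monoʳ-≤ _ (count-∪ ((_≟ x) ∪? (_≟ y)) B?) ⟩
    count (page? c x y) + (count ((_≟ x) ∪? (_≟ y)) + count B?)
      ≤⟨ +-monoʳ-≤ _ (+-monoˡ-≤ _ (≤-trans (count-∪ (_≟ x) (_≟ y)) (+-mono-≤ (count-singleton≤1 x) (count-singleton≤1 y)))) ⟩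
    count (page? c x y) + (2 + count B?)         ∎
    where
    open ≤-Reasoning
    B? = edge? G c x ∪? edge? G c y
    xyB? = ((_≟ x) ∪? (_≟ y)) ∪? B?
    cover : ∀ z → Page c x y z ⊎ (((z ≡ x) ⊎ (z ≡ y)) ⊎ (Edge G c x z ⊎ Edge G c y z))
    cover z with z ≟ x | z ≟ y | edge? G c x z | edge? G c y z
    ... | yes p | _     | _     | _     = inj₂ (inj₁ (inj₁ p))
    ... | no _  | yes p | _     | _     = inj₂ (inj₁ (inj₂ p))
    ... | no _  | no _  | yes p | _     = inj₂ (inj₂ (inj₁ p))
    ... | no _  | no _  | no _  | yes p = inj₂ (inj₂ (inj₂ p))
    ... | no p  | no q  | no r  | no s  = inj₁ ((p , q) , r , s)

¬wideBook⇒spread : (G : Gallai n) → 12 ≤ n → ¬ WideBook G → Spread G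
¬wideBook⇒spread {n} G 12≤n ¬book {c} {x} {y} x≢y ¬e = +-cancelˡ-≤ 8 4 _ (begin
  12                                              ≤⟨ 12≤n ⟩
  -- At most 6 pages and the 2 spine vertices leave at least 4 vertices joined by `c` to the spine.
  n                                               ≤⟨ vertices≤pages+neighbours G c x y ⟩
  count (page? G c x y) + (2 + count B?)          ≤⟨ +-monoˡ-≤ _ (s≤s⁻¹ (≰⇒> λ 7≤ → ¬book (c , x , y , (x≢y , ¬e) , 7≤))) ⟩
  6 + (2 + count B?)                              ≡⟨⟩
  8 + count B?                                    ∎)
  where
  open ≤-Reasoning
  B? = edge? G c x ∪? edge? G c y

wideBook : (G : Gallai 12) → WideBook G
wideBook G = decidable-stable (wideBook? G) λ ¬book →
  ¬spread {9} ≤-refl G (¬wideBook⇒spread G ≤-refl ¬book)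

module _ (f : Colouring 3 (K n)) (gallai : IsGallai f) where

  wideBook⇒copy : WideBook (matrix f gallai) → ∃[ b ] UsesAtMost {G = Book 7} 2 f b
  wideBook⇒copy (c , x , y , (x≢y , ¬e) , 7≤) with choose (page? (matrix f gallai) c x y) 7≤
  -- The set of allowed colours consists of all colours but `c`.
  ... | g , g-inj , pages = copy , ∁ ⁅ c ⁆ , size-∁ c , λ u v e → x∉p⇒x∈∁p λ c∈ →
      avoids u v e (matrix-edge f gallai (Copy.preserves copy {u} {v} e) (x∈⁅y⁆⇒x≡y c c∈))
    where
    G = matrix f gallai
    h : Vertex (Book 7) → Fin n
    h (inj₁ zero)       = x
    h (inj₁ (suc zero)) = y
    h (inj₂ i)          = g i
    h-inj : Injective _≡_ _≡_ h
    h-inj {inj₁ zero}       {inj₁ zero}       eq = refl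
    h-inj {inj₁ zero}       {inj₁ (suc zero)} eq = contradiction eq x≢y
    h-inj {inj₁ (suc zero)} {inj₁ zero}       eq = contradiction (sym eq) x≢y
    h-inj {inj₁ (suc zero)} {inj₁ (suc zero)} eq = refl
    h-inj {inj₁ zero}       {inj₂ i}          eq = contradiction (sym eq) (proj₁ (proj₁ (pages i)))
    h-inj {inj₁ (suc zero)} {inj₂ i}          eq = contradiction (sym eq) (proj₂ (proj₁ (pages i)))
    h-inj {inj₂ i}          {inj₁ zero}       eq = contradiction eq (proj₁ (proj₁ (pages i)))
    h-inj {inj₂ i}          {inj₁ (suc zero)} eq = contradiction eq (proj₂ (proj₁ (pages i)))
    h-inj {inj₂ i}          {inj₂ j}          eq = cong inj₂ (g-inj eq)
    copy : Copy (Book 7) (K n)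
    copy = embedding⇒copy h h-inj
    avoids : ∀ u v → Adj (Book 7) u v → ¬ Edge G c (h u) (h v)
    avoids (inj₁ zero)       (inj₁ zero)       e = contradiction refl e
    avoids (inj₁ zero)       (inj₁ (suc zero)) _ = ¬e
    avoids (inj₁ (suc zero)) (inj₁ zero)       _ = ¬e ∘ edge-sym G
    avoids (inj₁ (suc zero)) (inj₁ (suc zero)) e = contradiction refl e
    avoids (inj₁ zero)       (inj₂ i)          _ = proj₁ (proj₂ (pages i))
    avoids (inj₁ (suc zero)) (inj₂ i)          _ = proj₂ (proj₂ (pages i))
    avoids (inj₂ i)          (inj₁ zero)       _ = proj₁ (proj₂ (pages i)) ∘ edge-sym G
    avoids (inj₂ i)          (inj₁ (suc zero)) _ = proj₂ (proj₂ (pages i)) ∘ edge-sym G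

upper-bound : GallaiRamseyProperty 3 2 (Book 7) 12
upper-bound f gallai = wideBook⇒copy f gallai (wideBook (matrix f gallai))

-- The lower bound

-- K₁₁ as a pentagon and a K₃,₃ with their complements inside two parts, and one colour between the parts.
-- The diagonal entries are never used.
extremal : Vec (Vec Colour 11) 11
extremal =
  (0F ∷ 1F ∷ 2F ∷ 2F ∷ 1F ∷ 0F ∷ 0F ∷ 0F ∷ 0F ∷ 0F ∷ 0F ∷ []) ∷
  (1F ∷ 0F ∷ 1F ∷ 2F ∷ 2F ∷ 0F ∷ 0F ∷ 0F ∷ 0F ∷ 0F ∷ 0F ∷ []) ∷
  (2F ∷ 1F ∷ 0F ∷ 1F ∷ 2F ∷ 0F ∷ 0F ∷ 0F ∷ 0F ∷ 0F ∷ 0F ∷ []) ∷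
  (2F ∷ 2F ∷ 1F ∷ 0F ∷ 1F ∷ 0F ∷ 0F ∷ 0F ∷ 0F ∷ 0F ∷ 0F ∷ []) ∷
  (1F ∷ 2F ∷ 2F ∷ 1F ∷ 0F ∷ 0F ∷ 0F ∷ 0F ∷ 0F ∷ 0F ∷ 0F ∷ []) ∷
  (0F ∷ 0F ∷ 0F ∷ 0F ∷ 0F ∷ 0F ∷ 2F ∷ 2F ∷ 1F ∷ 1F ∷ 1F ∷ []) ∷
  (0F ∷ 0F ∷ 0F ∷ 0F ∷ 0F ∷ 2F ∷ 0F ∷ 2F ∷ 1F ∷ 1F ∷ 1F ∷ []) ∷
  (0F ∷ 0F ∷ 0F ∷ 0F ∷ 0F ∷ 2F ∷ 2F ∷ 0F ∷ 1F ∷ 1F ∷ 1F ∷ []) ∷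
  (0F ∷ 0F ∷ 0F ∷ 0F ∷ 0F ∷ 1F ∷ 1F ∷ 1F ∷ 0F ∷ 2F ∷ 2F ∷ []) ∷
  (0F ∷ 0F ∷ 0F ∷ 0F ∷ 0F ∷ 1F ∷ 1F ∷ 1F ∷ 2F ∷ 0F ∷ 2F ∷ []) ∷
  (0F ∷ 0F ∷ 0F ∷ 0F ∷ 0F ∷ 1F ∷ 1F ∷ 1F ∷ 2F ∷ 2F ∷ 0F ∷ []) ∷ []

abstract
  hue : Fin 11 → Fin 11 → Colour
  hue x y = lookup (lookup extremal x) y

  hue-sym : ∀ x y → hue x y ≡ hue y x
  hue-sym = toWitness {a? = all? λ x → all? λ y → hue x y ≟ hue y x} tt

  -- Checked exhaustively. Each part uses only the colours `1F` and `2F`, and a triangle meeting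
  -- both parts has two edges of colour `0F`.
  hue-gallai : ∀ x y z → x ≢ y → x ≢ z → y ≢ z → hue x y ≡ hue x z ⊎ hue x y ≡ hue y z ⊎ hue x z ≡ hue y z
  hue-gallai = toWitness {a? = all? λ x → all? λ y → all? λ z →
    ¬? (x ≟ y) →-dec ¬? (x ≟ z) →-dec ¬? (y ≟ z) →-dec
    (hue x y ≟ hue x z ⊎-dec hue x y ≟ hue y z ⊎-dec hue x z ≟ hue y z)} tt

HuePage : Colour → Fin 11 → Fin 11 → Pred (Fin 11) 0ℓ
HuePage c x y z = (z ≢ x × z ≢ y) × hue x z ≢ c × hue y z ≢ c

huePage? : ∀ c x y → Decidable (HuePage c x y)
huePage? c x y z = (¬? (z ≟ x) ×-dec ¬? (z ≟ y)) ×-dec ¬? (hue x z ≟ c) ×-dec ¬? (hue y z ≟ c)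

abstract
  -- Checked exhaustively. At least 3 of the 9 vertices off the spine are joined to it by `c`; for
  -- example, two vertices of the pentagon not adjacent in it have exactly 3 pentagon neighbours
  -- between them.
  hue-narrow : ∀ c x y → x ≢ y → hue x y ≢ c → count (huePage? c x y) ≤ 6
  hue-narrow = toWitness {a? = all? λ c → all? λ x → all? λ y →
    ¬? (x ≟ y) →-dec ¬? (hue x y ≟ c) →-dec count (huePage? c x y) ≤? 6} tt

-- Leastness concerns every smaller order, so the colouring of K₁₁ is restricted to its first `m`
-- vertices.
module _ (m≤11 : m ≤ 11) where

  private
    ι : Fin m → Fin 11
    ι x = inject≤ x m≤11

    ι-≢ : ∀ {x y} → x ≢ y → ι x ≢ ι y
    ι-≢ x≢y = x≢y ∘ inject≤-injective m≤11 m≤11 _ _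

  colouring : Colouring 3 (K m)
  colouring = record { colour = λ x y _ → hue (ι x) (ι y) ; symmetric = λ x y _ → hue-sym (ι x) (ι y) }

  colouring-gallai : IsGallai colouring
  colouring-gallai x y z xy xz yz (p , q , r) =
    [ p , [ q , r ]′ ]′ (hue-gallai (ι x) (ι y) (ι z) (ι-≢ xy) (ι-≢ xz) (ι-≢ yz))

  -- A copy in two colours avoids some `c`, and its seven pages would then all be counted by
  -- `huePage?`, which allows at most six.
  colouring-bookless : ¬ (∃[ b ] UsesAtMost {G = Book 7} 2 colouring b)
  colouring-bookless (b , S , ∣S∣≤2 , uses) with avoided-colour S ∣S∣≤2
  ... | c , c∉S = toWitnessFalse {a? = 7 ≤? 6} tt (≤-trans
      (injective⇒≤count (huePage? c (at x) (at y)) (at ∘ page) (inj₂-injective ∘ Copy.injective b ∘ inject≤-injective m≤11 m≤11 _ _)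
        λ i → (apart (λ ()) , apart (λ ())) , avoids x (page i) tt , avoids y (page i) tt)
      (hue-narrow c (at x) (at y) (apart λ ()) (avoids x y λ ())))
    where
    at : Vertex (Book 7) → Fin 11
    at = ι ∘ Copy.embed b
    x = spine zero
    y = spine (suc zero)
    apart : ∀ {u v} → u ≢ v → at u ≢ at v
    apart u≢v = ι-≢ (u≢v ∘ Copy.injective b)
    avoids : ∀ u v → Adj (Book 7) u v → hue (at u) (at v) ≢ c
    avoids u v e eq = c∉S (subst (_∈ S) eq (uses u v e))

theorem4p3 : IsWeakenedGallaiRamseyNumber 3 2 (s≤s z≤n) (s≤s (s≤s (s≤s z≤n))) (Book 7) 12
theorem4p3 = upper-bound , λ q property → ≮⇒≥ λ q<12 →
  colouring-bookless (s≤s⁻¹ q<12) (property (colouring (s≤s⁻¹ q<12)) (colouring-gallai (s≤s⁻¹ q<12)))
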